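{- Let $G=(V,E)$ be a graph. The following statements are equivalent: (1) $G$ is dual-critical. (2) For every given vertex $v\in V$ there is an acyclic orientation of $G$ in which all indegrees are odd except for that of $v$. (3) $|V|\not\equiv|E| \pmod 2$, and for every set $T\subsetneq V$ with $|T|\equiv|E| \pmod 2$ there exists a $T$-odd acyclic orientation of $G$. (4) Either $G$ is the graph consisting of one vertex (and no edges), or $V$ has a partition into two classes $V=A\cup B$ such that the induced subgraphs $G[A]$ and $G[B]$ are dual-critical and the number $d(A,B)$ of edges between $A$ and $B$ is odd.
   Context: Graphs are finite, undirected, with non-empty vertex set; parallel edges and loops are allowed. An orientation of $G$ is acyclic if it has no directed cycle (a loop oriented in any way is a directed cycle). A graph is dual-critical if it has an acyclic orientation in which all vertices except exactly one have odd indegree (the exceptional vertex is then necessarily the unique source). For $T\subseteq V$, an orientation is $T$-odd if every vertex of $T$ has odd indegree and every vertex of $V-T$ has even indegree. Classes of a partition are non-empty. -}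

module Defs where

open import Data.Bool using (Bool; if_then_else_)
open import Data.Fin using (Fin; _≟_)
open import Data.Fin.Subset
  using (Subset; _∈_; _∉_; _⊆_; _∩_; _∪_; ∣_∣; Nonempty; Empty)
open import Data.Fin.Subset.Properties using (_∈?_; p⊆p∪q; q⊆p∪q; x∈p∩q⁻)
open import Data.List using (List; []; _∷_)
open import Data.List.Relation.Unary.Unique.Propositional using (Unique)
open import Data.Nat using (ℕ; parity)
open import Data.Parity using (0ℙ; 1ℙ)
open import Data.Product using (∃; ∃-syntax; _×_; _,_; proj₁; proj₂; swap)
open import Data.Sum using (_⊎_)
open import Data.Vec using (tabulate)
open import Data.Vec.Properties using (lookup∘tabulate; []=⇒lookup)
open import Relation.Binary.PropositionalEquality
  using (_≡_; _≢_; subst; sym; trans)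
open import Relation.Nullary using (¬_; yes; does; _×-dec_; _⊎-dec_)
open import Relation.Unary using (Pred; Decidable)
open import Level using (0ℓ)

private variable
  n m : ℕ

infix 4 _≡₂_
_≡₂_ : ℕ → ℕ → Set
a ≡₂ b = parity a ≡ parity b

Even Odd : ℕ → Set
Even a = parity a ≡ 0ℙ
Odd  a = parity a ≡ 1ℙ

⟦_⟧ : {P : Pred (Fin n) 0ℓ} → Decidable P → Subset n
⟦ P? ⟧ = tabulate (λ x → does (P? x))

∈⟦⟧⁻ : {P : Pred (Fin n) 0ℓ} (P? : Decidable P) {x : Fin n} → x ∈ ⟦ P? ⟧ → P x
∈⟦⟧⁻ P? {x} x∈
  with P? x | trans (sym (lookup∘tabulate (λ y → does (P? y)) x)) ([]=⇒lookup x∈)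
... | yes p | _ = p

-- The vertex and edge sets are finite sets of names drawn from Fin n and
-- Fin m, so that a subgraph is a graph on the same names.  The edges are
-- undirected: the order in which `ends` lists the two end vertices of an edge
-- is only a reference for `Orientation` below.  Loops and parallel edges are
-- allowed.  The value of `ends` at a name outside E is never used.
record Graph (n m : ℕ) : Set where
  field
    V          : Subset n
    E          : Subset m
    ends       : Fin m → Fin n × Fin n
    V-nonempty : Nonempty V
    ends∈V     : ∀ {e} → e ∈ E → proj₁ (ends e) ∈ V × proj₂ (ends e) ∈ V

-- `true` directs an edge from its first to its second listed end.
Orientation : Graph n m → Set
Orientation {m = m} _ = Fin m → Bool

module _ (G : Graph n m) where
  open Graph G

  module _ (o : Orientation G) where

    arc : Fin m → Fin n × Fin n
    arc e = if o e then ends e else swap (ends e)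

    tail head : Fin m → Fin n
    tail e = proj₁ (arc e)
    head e = proj₂ (arc e)

    indegree : Fin n → ℕ
    indegree v = ∣ E ∩ ⟦ (λ e → head e ≟ v) ⟧ ∣

    Arc : Fin n → Fin n → Set
    Arc u w = ∃[ e ] e ∈ E × tail e ≡ u × head e ≡ w

    -- A non-empty directed walk; the list records every vertex visited, with
    -- the starting vertex but without the last stop.
    data Walk : Fin n → List (Fin n) → Fin n → Set where
      [_] : ∀ {u w} → Arc u w → Walk u (u ∷ []) w
      _∷_ : ∀ {u x us w} → Arc u x → Walk x us w → Walk u (u ∷ us) w

    -- An oriented loop is a directed cycle of length one.
    DirectedCycle : Set
    DirectedCycle = ∃[ v ] ∃[ us ] Walk v us v × Unique us

    Acyclic : Set
    Acyclic = ¬ DirectedCycle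

    OddExceptAt : Fin n → Set
    OddExceptAt v =
      Even (indegree v) × (∀ u → u ∈ V → u ≢ v → Odd (indegree u))

    IsOdd : Subset n → Set
    IsOdd T = ∀ v → v ∈ V →
      (v ∈ T → Odd (indegree v)) × (v ∉ T → Even (indegree v))

  DualCritical : Set
  DualCritical = ∃[ o ] Acyclic o × (∃[ v ] v ∈ V × OddExceptAt o v)

  BothEndsIn : Subset n → Fin m → Set
  BothEndsIn A e = proj₁ (ends e) ∈ A × proj₂ (ends e) ∈ A

  bothEndsIn? : ∀ A → Decidable (BothEndsIn A)
  bothEndsIn? A e = (proj₁ (ends e) ∈? A) ×-dec (proj₂ (ends e) ∈? A)

  induced : (A : Subset n) → A ⊆ V → Nonempty A → Graph n m
  induced A _ A≠∅ = record
    { V          = A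
    ; E          = E ∩ ⟦ bothEndsIn? A ⟧
    ; ends       = ends
    ; V-nonempty = A≠∅
    ; ends∈V     = λ e∈ →
        ∈⟦⟧⁻ (bothEndsIn? A) (proj₂ (x∈p∩q⁻ E ⟦ bothEndsIn? A ⟧ e∈))
    }

  Between : Subset n → Subset n → Fin m → Set
  Between A B e = (proj₁ (ends e) ∈ A × proj₂ (ends e) ∈ B)
                ⊎ (proj₁ (ends e) ∈ B × proj₂ (ends e) ∈ A)

  between? : ∀ A B → Decidable (Between A B)
  between? A B e = ((proj₁ (ends e) ∈? A) ×-dec (proj₂ (ends e) ∈? B))
            ⊎-dec ((proj₁ (ends e) ∈? B) ×-dec (proj₂ (ends e) ∈? A))

  d : Subset n → Subset n → ℕ
  d A B = ∣ E ∩ ⟦ between? A B ⟧ ∣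

  record IsPartition (A B : Subset n) : Set where
    field
      A-nonempty : Nonempty A
      B-nonempty : Nonempty B
      disjoint   : Empty (A ∩ B)
      cover      : A ∪ B ≡ V

    A⊆V : A ⊆ V
    A⊆V x∈A = subst (_ ∈_) cover (p⊆p∪q B x∈A)

    B⊆V : B ⊆ V
    B⊆V x∈B = subst (_ ∈_) cover (q⊆p∪q A B x∈B)

    G[A] G[B] : Graph n m
    G[A] = induced A A⊆V A-nonempty
    G[B] = induced B B⊆V B-nonempty

{-# OPTIONS --safe #-}
module Submission where

-- Call G flexible if |E| ≡ |V| + 1 (mod 2) and every prescription of indegree
-- parities with sum |E| is met by some acyclic orientation; this is (3) with T
-- read as a function to ℤ/2, and it contains (2).
--
-- If V = A ∪ B with G[A] and G[B] flexible and d(A,B) odd, then G is flexible: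
-- a prescription has the right sum on exactly one class, say A.  Orient G[A] as
-- prescribed, all crossing edges from A to B, and G[B] with the prescription
-- corrected by the crossing arcs, which then has the right sum on B.
--
-- Conversely take an acyclic orientation in which every vertex but s has odd
-- indegree, and delete a sink v.  By induction G - v is flexible.  If v were s,
-- all indegrees of G - v would be odd and |E| ≡ |V| there, contradicting
-- flexibility.  Hence d(V - v, {v}), the indegree of v, is odd.

open import Defs
open import Data.Nat using (ℕ)
open import Data.Fin.Subset using (_∈_; _⊂_; ∣_∣)
open import Data.Product using (∃-syntax; Σ-syntax; _×_)
open import Data.Sum using (_⊎_)
open import Function.Bundles using (_⇔_)
open import Relation.Binary.PropositionalEquality using (_≡_)
open import Relation.Nullary using (¬_)

open import Data.Bool using (Bool; true; false; if_then_else_)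
open import Data.Empty using (⊥-elim)
open import Data.Fin using (Fin; zero; suc; _≟_)
open import Data.Fin.Properties using (any?)
open import Data.Fin.Subset
  using (Subset; _∉_; _⊆_; _∩_; _∪_; _-_; ⁅_⁆; ⊤; Nonempty; Empty)
open import Data.Fin.Subset.Induction using (⊂-wellFounded)
open import Data.Fin.Subset.Properties
open import Data.List using ([]; _∷_; _∷ʳ_)
import Data.List.Membership.Propositional as List
open import Data.List.Membership.Propositional.Properties using (∈-++⁺ˡ; ∈-++⁺ʳ)
open import Data.List.Relation.Unary.Any using (here; there)
open import Data.List.Relation.Unary.All using ([])
open import Data.List.Relation.Unary.AllPairs using ([]; _∷_)
open import Data.List.Relation.Unary.Unique.Propositional using (Unique)
open import Data.List.Relation.Unary.Unique.Propositional.Properties using (++⁺)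
open import Data.Nat using (suc; pred; parity; _≤_)
open import Data.Nat.Properties using (1+n≰n)
open import Data.Parity using (Parity; 0ℙ; 1ℙ; _+_)
open import Data.Parity.Properties
  using (+-assoc; +-comm; +-identityʳ; +-cancelˡ-≡; +-commutativeSemigroup; p+p≡0ℙ; p≢p⁻¹;
    suc-homo-⁻¹; ⁻¹-selfInverse)
  renaming (_≟_ to _≟ℙ_)
open import Algebra.Properties.CommutativeSemigroup +-commutativeSemigroup
  using (interchange; x∙yz≈y∙xz)
open import Data.Product using (_,_; proj₁; proj₂; swap)
open import Data.Sum using (inj₁; inj₂; [_,_]′)
import Data.Sum as Sum
open import Data.Vec using ([]; _∷_; here; there; lookup)
open import Data.Vec.Properties using (lookup∘tabulate; []=⇒lookup; lookup⇒[]=)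
open import Function using (_∘_; const; mk⇔)
open import Induction.WellFounded using (Acc; acc)
open import Level using (0ℓ)
open import Relation.Binary.PropositionalEquality
  using (_≢_; refl; sym; trans; cong; cong₂; subst; module ≡-Reasoning)
open import Relation.Nullary using (yes; no; does; ¬?; _×-dec_)
open import Relation.Nullary.Decidable using (dec-true; decidable-stable)
open import Relation.Unary using (Pred; Decidable)

private variable
  n m : ℕ

-- Parities of sums over subsets

ι : Bool → Parity
ι b = if b then 1ℙ else 0ℙ

∑ : Subset n → (Fin n → Parity) → Parity
∑ []          t = 0ℙ
∑ (true  ∷ W) t = t zero + ∑ W (t ∘ suc)
∑ (false ∷ W) t = ∑ W (t ∘ suc)

parity-suc : ∀ k → parity (suc k) ≡ 1ℙ + parity k
parity-suc k = sym (⁻¹-selfInverse (suc-homo-⁻¹ k))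

parity-∷ : ∀ b (S : Subset n) → parity ∣ b ∷ S ∣ ≡ ι b + parity ∣ S ∣
parity-∷ true  S = parity-suc ∣ S ∣
parity-∷ false S = refl

p+[p+q]≡q : ∀ p q → p + (p + q) ≡ q
p+[p+q]≡q p q = trans (sym (+-assoc p p q)) (cong (_+ q) (p+p≡0ℙ p))

p≢1+p : ∀ {p} → p ≢ 1ℙ + p
p≢1+p {p} = p≢p⁻¹ p

-- There are only two parities, so both `q` and `r` must be the one other than `p`.
p≢q∧p≡1+r⇒r≡q : ∀ {p q r} → p ≢ q → p ≡ 1ℙ + r → r ≡ q
p≢q∧p≡1+r⇒r≡q {0ℙ} {0ℙ}      p≢q _ = ⊥-elim (p≢q refl)
p≢q∧p≡1+r⇒r≡q {1ℙ} {1ℙ}      p≢q _ = ⊥-elim (p≢q refl)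
p≢q∧p≡1+r⇒r≡q {0ℙ} {1ℙ} {1ℙ} p≢q _ = refl
p≢q∧p≡1+r⇒r≡q {1ℙ} {0ℙ} {0ℙ} p≢q _ = refl

∑-cong : ∀ (W : Subset n) {t u} → (∀ {v} → v ∈ W → t v ≡ u v) → ∑ W t ≡ ∑ W u
∑-cong []          eq = refl
∑-cong (true  ∷ W) eq = cong₂ _+_ (eq here) (∑-cong W (eq ∘ there))
∑-cong (false ∷ W) eq = ∑-cong W (eq ∘ there)

∑-+ : ∀ (W : Subset n) t u → ∑ W (λ v → t v + u v) ≡ ∑ W t + ∑ W u
∑-+ []          t u = refl
∑-+ (true  ∷ W) t u = trans
  (cong (t zero + u zero +_) (∑-+ W (t ∘ suc) (u ∘ suc)))
  (interchange (t zero) (u zero) _ _)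
∑-+ (false ∷ W) t u = ∑-+ W (t ∘ suc) (u ∘ suc)

∑-0 : ∀ (W : Subset n) → ∑ W (const 0ℙ) ≡ 0ℙ
∑-0 []          = refl
∑-0 (true  ∷ W) = ∑-0 W
∑-0 (false ∷ W) = ∑-0 W

∑-1 : ∀ (W : Subset n) → ∑ W (const 1ℙ) ≡ parity ∣ W ∣
∑-1 []          = refl
∑-1 (true  ∷ W) = trans (cong (1ℙ +_) (∑-1 W)) (sym (parity-∷ true W))
∑-1 (false ∷ W) = ∑-1 W

∑-δ : ∀ {x} {W : Subset n} → x ∈ W → ∑ W (λ v → ι (does (x ≟ v))) ≡ 1ℙ
∑-δ {W = _ ∷ W}     here      = cong (1ℙ +_) (∑-0 W)
∑-δ {W = true  ∷ W} (there i) = ∑-δ i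
∑-δ {W = false ∷ W} (there i) = ∑-δ i

∑-∪ : ∀ (A B : Subset n) t → Empty (A ∩ B) → ∑ (A ∪ B) t ≡ ∑ A t + ∑ B t
∑-∪ []          []          t dis = refl
∑-∪ (true  ∷ A) (true  ∷ B) t dis = ⊥-elim (dis (zero , here))
∑-∪ (true  ∷ A) (false ∷ B) t dis = trans
  (cong (t zero +_) (∑-∪ A B (t ∘ suc) (drop-∷-Empty dis)))
  (sym (+-assoc (t zero) _ _))
∑-∪ (false ∷ A) (true  ∷ B) t dis = trans
  (cong (t zero +_) (∑-∪ A B (t ∘ suc) (drop-∷-Empty dis)))
  (x∙yz≈y∙xz (t zero) (∑ A (t ∘ suc)) _)
∑-∪ (false ∷ A) (false ∷ B) t dis = ∑-∪ A B (t ∘ suc) (drop-∷-Empty dis)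

∑-lookup : ∀ (W T : Subset n) → ∑ W (ι ∘ lookup T) ≡ parity ∣ W ∩ T ∣
∑-lookup []          []      = refl
∑-lookup (true  ∷ W) (b ∷ T) =
  trans (cong (ι b +_) (∑-lookup W T)) (sym (parity-∷ b (W ∩ T)))
∑-lookup (false ∷ W) (b ∷ T) = ∑-lookup W T

⁅x⁆⊆p : ∀ {x} {p : Subset n} → x ∈ p → ⁅ x ⁆ ⊆ p
⁅x⁆⊆p {x = x} {p} x∈p y∈ = subst (_∈ p) (sym (x∈⁅y⁆⇒x≡y x y∈)) x∈p

∈⇒1≤∣p∣ : ∀ {x} {p : Subset n} → x ∈ p → 1 ≤ ∣ p ∣
∈⇒1≤∣p∣ {x = x} {p} x∈p = subst (_≤ ∣ p ∣) (∣⁅x⁆∣≡1 x) (p⊆q⇒∣p∣≤∣q∣ (⁅x⁆⊆p x∈p))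

∣p∣≡0⇒Empty : ∀ {p : Subset n} → ∣ p ∣ ≡ 0 → Empty p
∣p∣≡0⇒Empty {p = p} eq (x , x∈p) = 1+n≰n (subst (1 ≤_) eq (∈⇒1≤∣p∣ x∈p))

Empty⇒∣p∣≡0 : ∀ {p : Subset n} → Empty p → ∣ p ∣ ≡ 0
Empty⇒∣p∣≡0 {n} e = trans (cong ∣_∣ (Empty-unique e)) (∣⊥∣≡0 n)

∑-empty : ∀ (W : Subset n) t → Empty W → ∑ W t ≡ 0ℙ
∑-empty W t e = trans (∑-cong W λ {v} v∈ → ⊥-elim (e (v , v∈))) (∑-0 W)

∑-singleton : ∀ {x} (W : Subset n) t → ∣ W ∣ ≡ 1 → x ∈ W → ∑ W t ≡ t x
∑-singleton (true ∷ W) t eq here =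
  trans (cong (t zero +_) (∑-empty W _ (∣p∣≡0⇒Empty (cong pred eq))))
        (+-identityʳ _)
∑-singleton (true ∷ W) t eq (there i) =
  ⊥-elim (∣p∣≡0⇒Empty (cong pred eq) (_ , i))
∑-singleton (false ∷ W) t eq (there i) = ∑-singleton W (t ∘ suc) eq i

parity-split : ∀ {S T U : Subset n} → (∀ {x} → x ∈ S → x ∈ T ⊎ x ∈ U) →
  T ⊆ S → U ⊆ S → (∀ {x} → x ∈ T → x ∉ U) →
  parity ∣ S ∣ ≡ parity ∣ T ∣ + parity ∣ U ∣
parity-split {S = S} {T} {U} to T⊆S U⊆S dis = begin
  parity ∣ S ∣                          ≡⟨ cong (parity ∘ ∣_∣) S≡T∪U ⟩
  parity ∣ T ∪ U ∣                      ≡⟨ sym (∑-1 (T ∪ U)) ⟩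
  ∑ (T ∪ U) (const 1ℙ)                  ≡⟨ ∑-∪ T U _ empty ⟩
  ∑ T (const 1ℙ) + ∑ U (const 1ℙ)       ≡⟨ cong₂ _+_ (∑-1 T) (∑-1 U) ⟩
  parity ∣ T ∣ + parity ∣ U ∣           ∎
  where
  open ≡-Reasoning
  S≡T∪U : S ≡ T ∪ U
  S≡T∪U = ⊆-antisym (x∈p∪q⁺ ∘ to) ([ T⊆S , U⊆S ]′ ∘ x∈p∪q⁻ T U)
  empty : Empty (T ∩ U)
  empty (x , x∈) = let x∈T , x∈U = x∈p∩q⁻ T U x∈ in dis x∈T x∈U

lookup-∉ : ∀ {x} {S : Subset n} → x ∉ S → lookup S x ≡ false
lookup-∉ {x = x} {S} x∉S with lookup S x in eq
... | true  = ⊥-elim (x∉S (lookup⇒[]= x S eq))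
... | false = refl

x∉p-x : ∀ (p : Subset n) x → x ∉ p - x
x∉p-x (_ ∷ p) (suc x) (there i) = x∉p-x p x i

parity-remove : ∀ {x} (S : Subset n) → x ∈ S → parity ∣ S ∣ ≡ 1ℙ + parity ∣ S - x ∣
parity-remove {x = x} S x∈S = trans
  (parity-split {T = ⁅ x ⁆} to
    (⁅x⁆⊆p x∈S)
    (p─q⊆p S ⁅ x ⁆)
    (λ y∈ → subst (_∉ S - x) (sym (x∈⁅y⁆⇒x≡y x y∈)) (x∉p-x S x)))
  (cong (λ k → parity k + parity ∣ S - x ∣) (∣⁅x⁆∣≡1 x))
  where
  to : ∀ {y} → y ∈ S → y ∈ ⁅ x ⁆ ⊎ y ∈ S - x
  to {y} y∈S with y ≟ x
  ... | yes refl = inj₁ (x∈⁅x⁆ x)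
  ... | no y≢x   = inj₂ (x∈p∧x≢y⇒x∈p-y y∈S y≢x)

-- Filtered subsets and counting by fibres

∈∩⟦⟧⁺ : ∀ {S : Subset n} {P : Pred (Fin n) 0ℓ} (P? : Decidable P) {x} →
  x ∈ S → P x → x ∈ S ∩ ⟦ P? ⟧
∈∩⟦⟧⁺ P? {x} x∈S px = x∈p∩q⁺ (x∈S ,
  lookup⇒[]= x _ (trans (lookup∘tabulate (does ∘ P?) x) (dec-true (P? x) px)))

∈∩⟦⟧⁻ : ∀ {S : Subset n} {P : Pred (Fin n) 0ℓ} (P? : Decidable P) {x} →
  x ∈ S ∩ ⟦ P? ⟧ → x ∈ S × P x
∈∩⟦⟧⁻ {S = S} P? x∈ with x∈S , x∈P ← x∈p∩q⁻ S ⟦ P? ⟧ x∈ = x∈S , ∈⟦⟧⁻ P? x∈P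

-- `∣ fibre E (head G o) v ∣` unfolds to `indegree G o v`. The edge set and the map are left general
-- so that crossing edges can be counted by head in the same way.
fibre : Subset m → (Fin m → Fin n) → Fin n → Subset m
fibre F h v = F ∩ ⟦ (λ e → h e ≟ v) ⟧

∈-fibre⁺ : ∀ {F : Subset m} (h : Fin m → Fin n) {v e} → e ∈ F → h e ≡ v → e ∈ fibre F h v
∈-fibre⁺ h {v} = ∈∩⟦⟧⁺ (λ e → h e ≟ v)

∈-fibre⁻ : ∀ {F : Subset m} (h : Fin m → Fin n) {v e} → e ∈ fibre F h v → e ∈ F × h e ≡ v
∈-fibre⁻ h {v} = ∈∩⟦⟧⁻ (λ e → h e ≟ v)

-- Each element of `F` lies in exactly one fibre over `W`, so in the induction on `F` it contributes
-- a single delta, of sum one. For `head` this is the handshake identity for indegrees.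
∑-fibres : ∀ (F : Subset m) (W : Subset n) (h : Fin m → Fin n) →
  (∀ {e} → e ∈ F → h e ∈ W) →
  ∑ W (λ v → parity ∣ fibre F h v ∣) ≡ parity ∣ F ∣
∑-fibres []          W h h∈W = ∑-0 W
∑-fibres (false ∷ F) W h h∈W = ∑-fibres F W (h ∘ suc) (h∈W ∘ there)
∑-fibres (true  ∷ F) W h h∈W = begin
  ∑ W (λ v → parity ∣ does (h zero ≟ v) ∷ rest v ∣)
    ≡⟨ ∑-cong W (λ {v} _ → parity-∷ (does (h zero ≟ v)) (rest v)) ⟩
  ∑ W (λ v → ι (does (h zero ≟ v)) + parity ∣ rest v ∣)
    ≡⟨ ∑-+ W _ _ ⟩
  ∑ W (λ v → ι (does (h zero ≟ v))) + ∑ W (λ v → parity ∣ rest v ∣)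
    ≡⟨ cong₂ _+_ (∑-δ (h∈W here)) (∑-fibres F W (h ∘ suc) (h∈W ∘ there)) ⟩
  1ℙ + parity ∣ F ∣
    ≡⟨ sym (parity-∷ true F) ⟩
  parity ∣ true ∷ F ∣ ∎
  where
  open ≡-Reasoning
  rest : ∀ v → Subset _
  rest v = fibre F (h ∘ suc) v

-- Walks and sinks

module _ (G : Graph n m) (o : Orientation G) where
  open Graph G

  Sink : Fin n → Set
  Sink v = ¬ (∃[ e ] e ∈ E × tail G o e ≡ v)

  tail∈V : ∀ {e} → e ∈ E → tail G o e ∈ V
  tail∈V {e} e∈E with o e
  ... | true  = proj₁ (ends∈V e∈E)
  ... | false = proj₂ (ends∈V e∈E)

  head∈V : ∀ {e} → e ∈ E → head G o e ∈ V
  head∈V {e} e∈E with o e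
  ... | true  = proj₂ (ends∈V e∈E)
  ... | false = proj₁ (ends∈V e∈E)

  arcEnds⇒BothEndsIn : ∀ {S} e → tail G o e ∈ S → head G o e ∈ S → BothEndsIn G S e
  arcEnds⇒BothEndsIn e t∈S h∈S with o e
  ... | true  = t∈S , h∈S
  ... | false = h∈S , t∈S

  BothEndsIn⇒arcEnds : ∀ {S} e → BothEndsIn G S e → tail G o e ∈ S × head G o e ∈ S
  BothEndsIn⇒arcEnds e e⊆S with o e
  ... | true  = e⊆S
  ... | false = swap e⊆S

  Between⇒arcEnds : ∀ {S T} e → Between G S T e →
    (tail G o e ∈ S × head G o e ∈ T) ⊎ (tail G o e ∈ T × head G o e ∈ S)
  Between⇒arcEnds e b with o e
  ... | true  = b
  ... | false = Sum.map swap swap (Sum.swap b)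

  arcEnds⇒Between : ∀ {S T} e → tail G o e ∈ S → head G o e ∈ T → Between G S T e
  arcEnds⇒Between e t∈S h∈T with o e
  ... | true  = inj₁ (t∈S , h∈T)
  ... | false = inj₂ (h∈T , t∈S)

  walkStart∈V : ∀ {u us w} → Walk G o u us w → u ∈ V
  walkStart∈V [ e , e∈E , refl , _ ]     = tail∈V e∈E
  walkStart∈V ((e , e∈E , refl , _) ∷ _) = tail∈V e∈E

  walkEnd∈V : ∀ {u us w} → Walk G o u us w → w ∈ V
  walkEnd∈V [ e , e∈E , _ , refl ] = head∈V e∈E
  walkEnd∈V (_ ∷ p)                = walkEnd∈V p

  snoc : ∀ {u us w x} → Walk G o u us w → Arc G o w x → Walk G o u (us ∷ʳ w) x
  snoc [ a ]   b = a ∷ [ b ]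
  snoc (a ∷ p) b = a ∷ snoc p b

  -- The part of the walk from its visit to `x` onwards visits a suffix of `us`, and a suffix of a
  -- duplicate-free list is duplicate-free.
  walkFrom : ∀ {u us w x} → Walk G o u us w → Unique us → x List.∈ us →
    ∃[ us′ ] Walk G o x us′ w × Unique us′
  walkFrom [ a ]   uq       (here refl) = _ , [ a ] , uq
  walkFrom (a ∷ p) uq       (here refl) = _ , a ∷ p , uq
  walkFrom (a ∷ p) (_ ∷ uq) (there x∈)  = walkFrom p uq x∈

  module _ (out : ∀ {v} → v ∈ V → ∃[ w ] Arc G o v w) where
    open import Data.List.Membership.DecPropositional (_≟_ {n}) using ()
      renaming (_∈?_ to _∈ᴸ?_)

    -- `rest` contains the vertices not yet visited and shrinks with each step.
    extendToCycle : ∀ {u us x} rest → Acc _⊂_ rest →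
      (∀ {y} → y List.∉ us → y ∈ rest) →
      Walk G o u us x → Unique us → DirectedCycle G o
    extendToCycle {us = us} {x} rest (acc rs) fresh p uq with x ∈ᴸ? us
    ... | yes x∈us = x , walkFrom p uq x∈us
    ... | no  x∉us = extendToCycle (rest - x) (rs (x∈p⇒p-x⊂p (fresh x∉us)))
      (λ y∉ → x∈p∧x≢y⇒x∈p-y (fresh (y∉ ∘ ∈-++⁺ˡ))
                 λ y≡x → y∉ (∈-++⁺ʳ us (here y≡x)))
      (snoc p (proj₂ (out (walkEnd∈V p))))
      (++⁺ uq ([] ∷ []) λ { (y∈us , here refl) → x∉us y∈us })

  -- Without a sink every vertex of `V` has an outgoing arc, so a walk can be prolonged until it
  -- returns to a visited vertex, which closes a directed cycle.
  sink : Acyclic G o → ∃[ v ] v ∈ V × Sink v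
  sink ac with any? (λ v → v ∈? V ×-dec ¬? (any? λ e → e ∈? E ×-dec tail G o e ≟ v))
  ... | yes s = s
  ... | no ¬s = ⊥-elim (ac (extendToCycle out ⊤ (⊂-wellFounded ⊤) (λ _ → ∈⊤)
                              [ proj₂ (out (proj₂ V-nonempty)) ] ([] ∷ [])))
    where
    out : ∀ {v} → v ∈ V → ∃[ w ] Arc G o v w
    out {v} v∈V with any? (λ e → e ∈? E ×-dec tail G o e ≟ v)
    ... | yes (e , e∈E , eq) = _ , e , e∈E , eq , refl
    ... | no ¬e = ⊥-elim (¬s (v , v∈V , ¬e))

  ∑-indegree : ∑ V (parity ∘ indegree G o) ≡ parity ∣ E ∣
  ∑-indegree = ∑-fibres E V (head G o) head∈V

module _ {G H : Graph n m} {o : Orientation G} {oᴴ : Orientation H} (S : Subset n) where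

  -- If no arc leaves `S`, membership in `S` spreads from the start of a walk to all its vertices.
  -- Taking `S` to be `⊤` gives plain transport of walks.
  walkForward : (∀ {u w} → u ∈ S → Arc G o u w → w ∈ S × Arc H oᴴ u w) →
    ∀ {u us w} → u ∈ S → Walk G o u us w → Walk H oᴴ u us w
  walkForward step u∈S [ a ]   = [ proj₂ (step u∈S a) ]
  walkForward step u∈S (a ∷ p) with x∈S , b ← step u∈S a = b ∷ walkForward step x∈S p

  -- The mirror image: if no arc enters `S` from outside, membership spreads from the end of a walk
  -- back to its start.
  walkBackward : (∀ {u w} → w ∈ S → Arc G o u w → u ∈ S × Arc H oᴴ u w) →
    ∀ {u us w} → w ∈ S → Walk G o u us w → u ∈ S × Walk H oᴴ u us w
  walkBackward step w∈S [ a ] with u∈S , b ← step w∈S a = u∈S , [ b ]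
  walkBackward step w∈S (a ∷ p)
    with x∈S , q ← walkBackward step w∈S p
    with u∈S , b ← step x∈S a = u∈S , b ∷ q

-- Gluing orientations of the two classes of a partition

module _ (G : Graph n m) where
  open Graph G

  -- The prescription is a function on all names, constrained only on `V`; thus one `t` serves `G`
  -- and its induced subgraphs without being restricted.
  Realises : (Fin n → Parity) → Orientation G → Set
  Realises t o = Acyclic G o × (∀ v → v ∈ V → parity (indegree G o v) ≡ t v)

  Flexible : Set
  Flexible = parity ∣ E ∣ ≡ 1ℙ + parity ∣ V ∣ ×
             (∀ t → ∑ V t ≡ parity ∣ E ∣ → ∃[ o ] Realises t o)

module _ {G : Graph n m} where
  open Graph G

  flip-partition : ∀ {A B} → IsPartition G A B → IsPartition G B A
  flip-partition {A} {B} p = record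
    { A-nonempty = B-nonempty
    ; B-nonempty = A-nonempty
    ; disjoint   = subst Empty (∩-comm A B) disjoint
    ; cover      = trans (∪-comm B A) cover
    } where open IsPartition p

  module _ {A B : Subset n} (p : IsPartition G A B) where
    open IsPartition p

    ∉A⇒∈B : ∀ {x} → x ∈ V → x ∉ A → x ∈ B
    ∉A⇒∈B x∈V x∉A with x∈p∪q⁻ A B (subst (_ ∈_) (sym cover) x∈V)
    ... | inj₁ x∈A = ⊥-elim (x∉A x∈A)
    ... | inj₂ x∈B = x∈B

    disj : ∀ {x} → x ∈ A → x ∉ B
    disj x∈A x∈B = disjoint (_ , x∈p∩q⁺ (x∈A , x∈B))

    -- The edges of the cut; `d G A B` is `∣ X ∣` by definition.
    X : Subset m
    X = E ∩ ⟦ between? G A B ⟧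

    ∑-partition : ∀ t → ∑ V t ≡ ∑ A t + ∑ B t
    ∑-partition t = trans (cong (λ W → ∑ W t) (sym cover)) (∑-∪ A B t disjoint)

    parity-V : parity ∣ V ∣ ≡ parity ∣ A ∣ + parity ∣ B ∣
    parity-V = trans (sym (∑-1 V)) (trans (∑-partition _) (cong₂ _+_ (∑-1 A) (∑-1 B)))

    X-not-within-B : ∀ {e} → e ∈ X → ¬ BothEndsIn G B e
    X-not-within-B e∈X (x∈B , y∈B) with ∈∩⟦⟧⁻ (between? G A B) e∈X
    ... | _ , inj₁ (x∈A , _) = disj x∈A x∈B
    ... | _ , inj₂ (_ , y∈A) = disj y∈A y∈B

    -- On the edges between A and B this is the direction from A to B.
    crossing : Orientation G
    crossing e = does (proj₁ (ends e) ∈? A)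

    module _ (oᴬ oᴮ : Orientation G) where

      -- Between the classes the two constants agree with `crossing`, so every such edge runs from
      -- `A` to `B`.
      glue : Orientation G
      glue e = if does (proj₁ (ends e) ∈? A)
        then (if does (proj₂ (ends e) ∈? A) then oᴬ e else true)
        else (if does (proj₂ (ends e) ∈? A) then false else oᴮ e)

      -- g and c stand for `glue e` and `crossing e`, generalised so that `position`
      -- can split on the membership tests inside both.
      data Position (e : Fin m) (g c : Bool) : Set where
        within-A : BothEndsIn G A e → g ≡ oᴬ e → Position e g c
        within-B : BothEndsIn G B e → g ≡ oᴮ e → Position e g c
        across   : tail G (const g) e ∈ A → head G (const g) e ∈ B → g ≡ c →
                   Position e g c

      position : ∀ {e} → e ∈ E → Position e (glue e) (crossing e)
      position {e} e∈E with proj₁ (ends e) ∈? A | proj₂ (ends e) ∈? A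
      ... | yes x∈A | yes y∈A = within-A (x∈A , y∈A) refl
      ... | yes x∈A | no  y∉A = across x∈A (∉A⇒∈B (proj₂ (ends∈V e∈E)) y∉A) refl
      ... | no  x∉A | yes y∈A = across y∈A (∉A⇒∈B (proj₁ (ends∈V e∈E)) x∉A) refl
      ... | no  x∉A | no  y∉A = within-B
        (∉A⇒∈B (proj₁ (ends∈V e∈E)) x∉A , ∉A⇒∈B (proj₂ (ends∈V e∈E)) y∉A) refl

      -- Induced subgraphs keep `ends`, so `arc G (const (oᴬ e)) e` is already `arc G[A] oᴬ e` by
      -- computation, and likewise for `B`. Hence this carries heads and tails between `glue` and
      -- the orientations of the classes.
      arc-cong : ∀ {e b} (o : Orientation G) → o e ≡ b → arc G o e ≡ arc G (const b) e
      arc-cong {e} o eq = cong (λ b → arc G (const b) e) eq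

      -- Crossing arcs have their heads in `B`, so nothing enters `A` from outside.
      head∈A : ∀ {e} → e ∈ E → head G glue e ∈ A → BothEndsIn G A e × glue e ≡ oᴬ e
      head∈A {e} e∈E h∈A with position e∈E
      ... | within-A e⊆A g = e⊆A , g
      ... | within-B e⊆B g = ⊥-elim (disj h∈A (proj₂ (BothEndsIn⇒arcEnds G glue e e⊆B)))
      ... | across _ h∈B _ = ⊥-elim (disj h∈A h∈B)

      -- Crossing arcs have their tails in `A`, so nothing leaves `B`.
      tail∈B : ∀ {e} → e ∈ E → tail G glue e ∈ B → BothEndsIn G B e × glue e ≡ oᴮ e
      tail∈B {e} e∈E t∈B with position e∈E
      ... | within-A e⊆A g = ⊥-elim (disj (proj₁ (BothEndsIn⇒arcEnds G glue e e⊆A)) t∈B)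
      ... | within-B e⊆B g = e⊆B , g
      ... | across t∈A _ _ = ⊥-elim (disj t∈A t∈B)

      -- A cycle based at a vertex of `A` stays in `A` when followed backwards; one based in `B`
      -- stays in `B` when followed forwards. Either way it is a cycle of one class.
      glue-acyclic : Acyclic G[A] oᴬ → Acyclic G[B] oᴮ → Acyclic G glue
      glue-acyclic acᴬ acᴮ (v , us , w , uq) with v ∈? A
      ... | yes v∈A = acᴬ (v , us , proj₂ (walkBackward A step v∈A w) , uq)
        where
        step : ∀ {u w} → w ∈ A → Arc G glue u w → u ∈ A × Arc G[A] oᴬ u w
        step w∈A (e , e∈E , refl , refl) with e⊆A , g ← head∈A e∈E w∈A =
          proj₁ (BothEndsIn⇒arcEnds G glue e e⊆A) ,
          e , ∈∩⟦⟧⁺ (bothEndsIn? G A) e∈E e⊆A ,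
          cong proj₁ (sym (arc-cong glue g)) , cong proj₂ (sym (arc-cong glue g))
      ... | no v∉A = acᴮ (v , us ,
              walkForward B step (∉A⇒∈B (walkStart∈V G glue w) v∉A) w , uq)
        where
        step : ∀ {u w} → u ∈ B → Arc G glue u w → w ∈ B × Arc G[B] oᴮ u w
        step u∈B (e , e∈E , refl , refl) with e⊆B , g ← tail∈B e∈E u∈B =
          proj₂ (BothEndsIn⇒arcEnds G glue e e⊆B) ,
          e , ∈∩⟦⟧⁺ (bothEndsIn? G B) e∈E e⊆B ,
          cong proj₁ (sym (arc-cong glue g)) , cong proj₂ (sym (arc-cong glue g))

      glue-indegree-A : ∀ {v} → v ∈ A → indegree G glue v ≡ indegree G[A] oᴬ v
      glue-indegree-A {v} v∈A = cong ∣_∣ (⊆-antisym to from)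
        where
        to : fibre E (head G glue) v ⊆ fibre (Graph.E G[A]) (head G[A] oᴬ) v
        to e∈ with e∈E , refl ← ∈-fibre⁻ (head G glue) e∈
              with e⊆A , g ← head∈A e∈E v∈A =
          ∈-fibre⁺ (head G[A] oᴬ) (∈∩⟦⟧⁺ (bothEndsIn? G A) e∈E e⊆A)
            (cong proj₂ (sym (arc-cong glue g)))
        from : fibre (Graph.E G[A]) (head G[A] oᴬ) v ⊆ fibre E (head G glue) v
        from {e} e∈ with e∈A , refl ← ∈-fibre⁻ (head G[A] oᴬ) e∈
                with e∈E , e⊆A ← ∈∩⟦⟧⁻ (bothEndsIn? G A) e∈A
                with _ , g ← head∈A e∈E (proj₂ (BothEndsIn⇒arcEnds G glue e e⊆A)) =
          ∈-fibre⁺ (head G glue) e∈E (cong proj₂ (arc-cong glue g))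

      -- Arcs into `v` come from within `B` or across the cut. The second term is expressed through
      -- `crossing`, independently of `oᴬ` and `oᴮ`, so it is known before `oᴮ` is chosen.
      glue-indegree-B : ∀ {v} → v ∈ B → parity (indegree G glue v) ≡
        parity (indegree G[B] oᴮ v) + parity ∣ fibre X (head G crossing) v ∣
      glue-indegree-B {v} v∈B = parity-split to fromᴮ fromˣ dis
        where
        to : ∀ {e} → e ∈ fibre E (head G glue) v →
             e ∈ fibre (Graph.E G[B]) (head G[B] oᴮ) v ⊎
             e ∈ fibre X (head G crossing) v
        to {e} e∈ with e∈E , refl ← ∈-fibre⁻ (head G glue) e∈ with position e∈E
        ... | within-A e⊆A g = ⊥-elim (disj (proj₂ (BothEndsIn⇒arcEnds G glue e e⊆A)) v∈B)
        ... | within-B e⊆B g = inj₁ (∈-fibre⁺ (head G[B] oᴮ)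
                (∈∩⟦⟧⁺ (bothEndsIn? G B) e∈E e⊆B) (cong proj₂ (sym (arc-cong glue g))))
        ... | across t∈A h∈B g = inj₂ (∈-fibre⁺ (head G crossing)
                (∈∩⟦⟧⁺ (between? G A B) e∈E (arcEnds⇒Between G glue e t∈A h∈B))
                (cong proj₂ (sym (arc-cong glue g))))
        fromᴮ : fibre (Graph.E G[B]) (head G[B] oᴮ) v ⊆ fibre E (head G glue) v
        fromᴮ {e} e∈ with e∈B , refl ← ∈-fibre⁻ (head G[B] oᴮ) e∈
                with e∈E , e⊆B ← ∈∩⟦⟧⁻ (bothEndsIn? G B) e∈B
                with _ , g ← tail∈B e∈E (proj₁ (BothEndsIn⇒arcEnds G glue e e⊆B)) =
          ∈-fibre⁺ (head G glue) e∈E (cong proj₂ (arc-cong glue g))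
        fromˣ : fibre X (head G crossing) v ⊆ fibre E (head G glue) v
        fromˣ {e} e∈ with e∈X , refl ← ∈-fibre⁻ (head G crossing) e∈
                with e∈E , _ ← ∈∩⟦⟧⁻ (between? G A B) e∈X with position e∈E
        ... | within-A e⊆A g = ⊥-elim (disj (proj₂ (BothEndsIn⇒arcEnds G crossing e e⊆A)) v∈B)
        ... | within-B e⊆B g = ⊥-elim (X-not-within-B e∈X e⊆B)
        ... | across t∈A h∈B g =
          ∈-fibre⁺ (head G glue) e∈E (cong proj₂ (arc-cong glue g))
        dis : ∀ {e} → e ∈ fibre (Graph.E G[B]) (head G[B] oᴮ) v →
              e ∉ fibre X (head G crossing) v
        dis e∈ e∈′ =
          X-not-within-B (proj₁ (∈-fibre⁻ (head G crossing) e∈′))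
            (proj₂ (∈∩⟦⟧⁻ (bothEndsIn? G B) (proj₁ (∈-fibre⁻ (head G[B] oᴮ) e∈))))

    crossing-head∈B : ∀ {e} → e ∈ X → head G crossing e ∈ B
    crossing-head∈B {e} e∈X with e∈E , b ← ∈∩⟦⟧⁻ (between? G A B) e∈X
                            with proj₁ (ends e) ∈? A
    ... | yes x∈A = [ proj₂ , (λ q → ⊥-elim (disj x∈A (proj₁ q))) ]′ b
    ... | no  x∉A = ∉A⇒∈B (proj₁ (ends∈V e∈E)) x∉A

    parity-E : parity ∣ E ∣ ≡
      parity ∣ Graph.E G[A] ∣ + (parity ∣ Graph.E G[B] ∣ + parity (d G A B))
    parity-E = trans
      (parity-split to (p∩q⊆p E _) [ p∩q⊆p E _ , p∩q⊆p E _ ]∪ disᴬ)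
      (cong (parity ∣ Graph.E G[A] ∣ +_) (parity-split {T = Graph.E G[B]} {X}
        (x∈p∪q⁻ _ _) (x∈p∪q⁺ ∘ inj₁) (x∈p∪q⁺ ∘ inj₂)
        (λ e∈B e∈X → X-not-within-B e∈X (proj₂ (∈∩⟦⟧⁻ {S = E} (bothEndsIn? G B) e∈B)))))
      where
      [_,_]∪ : ∀ {S T U : Subset m} → S ⊆ U → T ⊆ U → S ∪ T ⊆ U
      [ f , g ]∪ e∈ = [ f , g ]′ (x∈p∪q⁻ _ _ e∈)
      to : ∀ {e} → e ∈ E → e ∈ Graph.E G[A] ⊎ e ∈ Graph.E G[B] ∪ X
      -- Only the trichotomy of edges matters here; `crossing` merely fills the two orientation
      -- slots.
      to {e} e∈E with position crossing crossing e∈E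
      ... | within-A e⊆A _ = inj₁ (∈∩⟦⟧⁺ (bothEndsIn? G A) e∈E e⊆A)
      ... | within-B e⊆B _ = inj₂ (x∈p∪q⁺ (inj₁ (∈∩⟦⟧⁺ (bothEndsIn? G B) e∈E e⊆B)))
      ... | across t∈A h∈B _ = inj₂ (x∈p∪q⁺ (inj₂ (∈∩⟦⟧⁺ (between? G A B) e∈E
              (arcEnds⇒Between G (glue crossing crossing) e t∈A h∈B))))
      disᴬ : ∀ {e} → e ∈ Graph.E G[A] → e ∉ Graph.E G[B] ∪ X
      disᴬ e∈A e∈ with e∈E , e⊆A ← ∈∩⟦⟧⁻ (bothEndsIn? G A) e∈A with x∈p∪q⁻ _ _ e∈
      ... | inj₁ e∈B = disj (proj₁ e⊆A) (proj₁ (proj₂ (∈∩⟦⟧⁻ (bothEndsIn? G B) e∈B)))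
      ... | inj₂ e∈X with ∈∩⟦⟧⁻ (between? G A B) e∈X
      ...   | _ , inj₁ (_ , y∈B) = disj (proj₂ e⊆A) y∈B
      ...   | _ , inj₂ (x∈B , _) = disj (proj₁ e⊆A) x∈B

    -- The class `A` receives no crossing arcs and can follow `t` itself. The class `B` follows
    -- `t′`, which discounts the crossing arcs into each vertex; modulo 2, adding `x v` is the same
    -- as subtracting it.
    realise-across : Flexible G[A] → Flexible G[B] → ∀ t →
      ∑ A t ≡ parity ∣ Graph.E G[A] ∣ → ∑ V t ≡ parity ∣ E ∣ → ∃[ o ] Realises G t o
    realise-across (_ , realiseᴬ) (_ , realiseᴮ) t tᴬ tⱽ =
      let oᴬ , acᴬ , inᴬ = realiseᴬ t tᴬ
          oᴮ , acᴮ , inᴮ = realiseᴮ t′ t′-sum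
      in glue oᴬ oᴮ , glue-acyclic oᴬ oᴮ acᴬ acᴮ , degrees oᴬ oᴮ inᴬ inᴮ
      where
      x : Fin n → Parity
      x v = parity ∣ fibre X (head G crossing) v ∣

      t′ : Fin n → Parity
      t′ v = x v + t v

      ∑x : ∑ B x ≡ parity ∣ X ∣
      ∑x = ∑-fibres X B (head G crossing) crossing-head∈B

      open ≡-Reasoning

      -- The sum over `B` is what remains of `∑ V t` after cancelling the sum over `A`, which is
      -- right by assumption.
      tᴮ : ∑ B t ≡ parity ∣ X ∣ + parity ∣ Graph.E G[B] ∣
      tᴮ = +-cancelˡ-≡ (∑ A t) _ _ (begin
        ∑ A t + ∑ B t ≡⟨ sym (∑-partition t) ⟩
        ∑ V t         ≡⟨ tⱽ ⟩
        parity ∣ E ∣  ≡⟨ parity-E ⟩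
        parity ∣ Graph.E G[A] ∣ + (parity ∣ Graph.E G[B] ∣ + parity ∣ X ∣)
          ≡⟨ cong₂ _+_ (sym tᴬ) (+-comm (parity ∣ Graph.E G[B] ∣) _) ⟩
        ∑ A t + (parity ∣ X ∣ + parity ∣ Graph.E G[B] ∣) ∎)

      t′-sum : ∑ B t′ ≡ parity ∣ Graph.E G[B] ∣
      t′-sum = trans (∑-+ B x t)
        (trans (cong₂ _+_ ∑x tᴮ) (p+[p+q]≡q (parity ∣ X ∣) _))

      degrees : ∀ oᴬ oᴮ →
        (∀ v → v ∈ A → parity (indegree G[A] oᴬ v) ≡ t v) →
        (∀ v → v ∈ B → parity (indegree G[B] oᴮ v) ≡ t′ v) →
        ∀ v → v ∈ V → parity (indegree G (glue oᴬ oᴮ) v) ≡ t v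
      degrees oᴬ oᴮ inᴬ inᴮ v v∈V with v ∈? A
      ... | yes v∈A = trans (cong parity (glue-indegree-A oᴬ oᴮ v∈A)) (inᴬ v v∈A)
      ... | no  v∉A = begin
        parity (indegree G (glue oᴬ oᴮ) v) ≡⟨ glue-indegree-B oᴬ oᴮ (∉A⇒∈B v∈V v∉A) ⟩
        parity (indegree G[B] oᴮ v) + x v  ≡⟨ cong (_+ x v) (inᴮ v (∉A⇒∈B v∈V v∉A)) ⟩
        (x v + t v) + x v                  ≡⟨ +-comm (x v + t v) (x v) ⟩
        x v + (x v + t v)                  ≡⟨ p+[p+q]≡q (x v) (t v) ⟩
        t v                                ∎

combine : ∀ {G : Graph n m} {A B} (p : IsPartition G A B) →
  Flexible (IsPartition.G[A] p) → Flexible (IsPartition.G[B] p) → Odd (d G A B) →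
  Flexible G
combine {G = G} {A} {B} p Fᴬ Fᴮ odd = count , realise
  where
  open Graph G
  open IsPartition p
  open ≡-Reasoning

  a b : Parity
  a = parity ∣ A ∣
  b = parity ∣ B ∣

  eᴬ eᴮ x : Parity
  eᴬ = parity ∣ Graph.E G[A] ∣
  eᴮ = parity ∣ Graph.E G[B] ∣
  x  = parity (d G A B)

  count : parity ∣ E ∣ ≡ 1ℙ + parity ∣ V ∣
  count = begin
    parity ∣ E ∣                  ≡⟨ parity-E p ⟩
    eᴬ + (eᴮ + x)                 ≡⟨ cong₂ _+_ (proj₁ Fᴬ) (cong₂ _+_ (proj₁ Fᴮ) odd) ⟩
    (1ℙ + a) + ((1ℙ + b) + 1ℙ)    ≡⟨ simplify a b ⟩
    1ℙ + (a + b)                  ≡⟨ cong (1ℙ +_) (sym (parity-V p)) ⟩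
    1ℙ + parity ∣ V ∣             ∎
    where
    simplify : ∀ a b → (1ℙ + a) + ((1ℙ + b) + 1ℙ) ≡ 1ℙ + (a + b)
    simplify 0ℙ 0ℙ = refl
    simplify 0ℙ 1ℙ = refl
    simplify 1ℙ 0ℙ = refl
    simplify 1ℙ 1ℙ = refl

  realise : ∀ t → ∑ V t ≡ parity ∣ E ∣ → ∃[ o ] Realises G t o
  realise t tⱽ with ∑ A t ≟ℙ eᴬ
  ... | yes tᴬ = realise-across p Fᴬ Fᴮ t tᴬ tⱽ
  -- Since the cut is odd, the sums over the two classes cannot both be wrong: `total` forces the
  -- one over `B` to be right once the one over `A` is wrong. The roles of the classes are then
  -- exchanged.
  ... | no tᴬ≢ = realise-across (flip-partition p) Fᴮ Fᴬ t (other _ _ _ _ tᴬ≢ total) tⱽ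
    where
    total : ∑ A t + ∑ B t ≡ eᴬ + (eᴮ + 1ℙ)
    total = begin
      ∑ A t + ∑ B t   ≡⟨ sym (∑-partition p t) ⟩
      ∑ V t           ≡⟨ tⱽ ⟩
      parity ∣ E ∣    ≡⟨ parity-E p ⟩
      eᴬ + (eᴮ + x)   ≡⟨ cong (λ x → eᴬ + (eᴮ + x)) odd ⟩
      eᴬ + (eᴮ + 1ℙ)  ∎
    other : ∀ p q r s → p ≢ q → p + r ≡ q + (s + 1ℙ) → r ≡ s
    other 0ℙ 0ℙ r  s  p≢q eq = ⊥-elim (p≢q refl)
    other 1ℙ 1ℙ r  s  p≢q eq = ⊥-elim (p≢q refl)
    other 0ℙ 1ℙ r  0ℙ p≢q eq = eq
    other 0ℙ 1ℙ r  1ℙ p≢q eq = eq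
    other 1ℙ 0ℙ 0ℙ 0ℙ p≢q eq = refl
    other 1ℙ 0ℙ 1ℙ 1ℙ p≢q eq = refl

-- Decomposing along a sink

Trivial : Graph n m → Set
Trivial G = ∣ Graph.V G ∣ ≡ 1 × ∣ Graph.E G ∣ ≡ 0

-- With a single vertex the sum condition itself makes the prescription there equal to the parity of
-- `∣ E ∣`, which is even, as is the indegree.
trivial-flexible : (G : Graph n m) → Trivial G → Flexible G
trivial-flexible G (∣V∣≡1 , ∣E∣≡0) =
  trans (cong parity ∣E∣≡0) (cong (λ k → 1ℙ + parity k) (sym ∣V∣≡1)) ,
  λ t tⱽ → const true ,
    (λ { (_ , _ , w , _) → acyclic w }) ,
    λ v v∈V → begin
      parity (indegree G (const true) v) ≡⟨ cong parity (no-arcs v) ⟩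
      0ℙ                                 ≡⟨ cong parity (sym ∣E∣≡0) ⟩
      parity ∣ E ∣                       ≡⟨ sym tⱽ ⟩
      ∑ V t                              ≡⟨ ∑-singleton V t ∣V∣≡1 v∈V ⟩
      t v                                ∎
  where
  open Graph G
  open ≡-Reasoning
  acyclic : ∀ {u us w} → ¬ Walk G (const true) u us w
  acyclic [ e , e∈E , _ ]     = ∣p∣≡0⇒Empty ∣E∣≡0 (e , e∈E)
  acyclic ((e , e∈E , _) ∷ _) = ∣p∣≡0⇒Empty ∣E∣≡0 (e , e∈E)
  no-arcs : ∀ v → indegree G (const true) v ≡ 0
  no-arcs v = Empty⇒∣p∣≡0 λ (e , e∈) → ∣p∣≡0⇒Empty ∣E∣≡0 (e , p∩q⊆p E _ e∈)

-- Statement (4) with flexible classes instead of dual-critical ones. The induction needs this form,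
-- because it uses flexibility of the smaller graph before dual-critical graphs are known to be
-- flexible.
Decomposable : Graph n m → Set
Decomposable G = Trivial G ⊎
  (∃[ A ] ∃[ B ] Σ[ p ∈ IsPartition G A B ]
     Flexible (IsPartition.G[A] p) × Flexible (IsPartition.G[B] p) × Odd (d G A B))

decomposable⇒flexible : (G : Graph n m) → Decomposable G → Flexible G
decomposable⇒flexible G (inj₁ trivial)                     = trivial-flexible G trivial
decomposable⇒flexible G (inj₂ (A , B , p , Fᴬ , Fᴮ , odd)) = combine p Fᴬ Fᴮ odd

remove-partition : ∀ (G : Graph n m) {v} → v ∈ Graph.V G → Nonempty (Graph.V G - v) →
  IsPartition G (Graph.V G - v) ⁅ v ⁆
remove-partition G {v} v∈V ne = record
  { A-nonempty = ne
  ; B-nonempty = v , x∈⁅x⁆ v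
  ; disjoint   = λ (x , x∈) → let x∈A , x∈v = x∈p∩q⁻ (V - v) ⁅ v ⁆ x∈
                              in x∉p-x V v (subst (_∈ V - v) (x∈⁅y⁆⇒x≡y v x∈v) x∈A)
  ; cover      = ⊆-antisym
      ([ p─q⊆p V ⁅ v ⁆ , ⁅x⁆⊆p v∈V ]′ ∘ x∈p∪q⁻ (V - v) ⁅ v ⁆) from
  }
  where
  open Graph G
  from : V ⊆ (V - v) ∪ ⁅ v ⁆
  from {x} x∈V with x ≟ v
  ... | yes refl = x∈p∪q⁺ (inj₂ (x∈⁅x⁆ v))
  ... | no  x≢v  = x∈p∪q⁺ (inj₁ (x∈p∧x≢y⇒x∈p-y x∈V x≢v))

-- Induction on `V`. The indegree of `s` is left open and `s` need not lie in `V`, so the hypothesis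
-- passes to the graph without the sink `v` even when `v` is `s`; that case is refuted only
-- afterwards.
decompose : ∀ (G : Graph n m) o s → Acc _⊂_ (Graph.V G) → Acyclic G o →
  (∀ u → u ∈ Graph.V G → u ≢ s → Odd (indegree G o u)) → Decomposable G
decompose {n} {m} G o s (acc rs) ac odd with sink G o ac
... | v , v∈V , sink-v with nonempty? (Graph.V G - v)
...   | no V-v≡∅ = inj₁ (trans (cong ∣_∣ V≡⁅v⁆) (∣⁅x⁆∣≡1 v) , Empty⇒∣p∣≡0 no-edge)
  where
  open Graph G
  only-v : ∀ {x} → x ∈ V → x ≡ v
  only-v {x} x∈V = decidable-stable (x ≟ v) λ x≢v → V-v≡∅ (x , x∈p∧x≢y⇒x∈p-y x∈V x≢v)
  V≡⁅v⁆ : V ≡ ⁅ v ⁆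
  V≡⁅v⁆ = ⊆-antisym (λ x∈V → subst (_∈ ⁅ v ⁆) (sym (only-v x∈V)) (x∈⁅x⁆ v)) (⁅x⁆⊆p v∈V)
  -- Any edge would be a loop at `v`, hence an arc leaving a sink.
  no-edge : Empty E
  no-edge (e , e∈E) = sink-v (e , e∈E , only-v (tail∈V G o e∈E))
...   | yes V-v≢∅ = inj₂ (V - v , ⁅ v ⁆ , p , Fᴬ , Fᴮ , odd-d)
  where
  open Graph G
  p : IsPartition G (V - v) ⁅ v ⁆
  p = remove-partition G v∈V V-v≢∅
  open IsPartition p

  tail∈A : ∀ {e} → e ∈ E → tail G o e ∈ V - v
  tail∈A {e} e∈E = x∈p∧x≢y⇒x∈p-y (tail∈V G o e∈E) λ t≡v → sink-v (e , e∈E , t≡v)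

  acᴬ : Acyclic G[A] o
  acᴬ (u , us , w , uq) = ac (u , us , walkForward ⊤ step ∈⊤ w , uq)
    where
    step : ∀ {u w} → u ∈ ⊤ → Arc G[A] o u w → w ∈ ⊤ × Arc G o u w
    step _ (e , e∈ , eqs) = ∈⊤ , e , p∩q⊆p E _ e∈ , eqs

  -- An arc into `u` does not start at the sink `v`, so deleting `v` loses none of the arcs into
  -- `u`.
  indegreeᴬ : ∀ {u} → u ∈ V - v → indegree G o u ≡ indegree G[A] o u
  indegreeᴬ {u} u∈A = cong ∣_∣ (⊆-antisym to from)
    where
    to : fibre E (head G o) u ⊆ fibre (Graph.E G[A]) (head G[A] o) u
    to {e} e∈ with e∈E , refl ← ∈-fibre⁻ (head G o) e∈ =
      ∈-fibre⁺ (head G[A] o) (∈∩⟦⟧⁺ (bothEndsIn? G (V - v)) e∈E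
        (arcEnds⇒BothEndsIn G o e (tail∈A e∈E) u∈A)) refl
    from : fibre (Graph.E G[A]) (head G[A] o) u ⊆ fibre E (head G o) u
    from e∈ with e∈A , eq ← ∈-fibre⁻ (head G[A] o) e∈ =
      ∈-fibre⁺ (head G o) (p∩q⊆p E _ e∈A) eq

  oddᴬ : ∀ u → u ∈ V - v → u ≢ s → Odd (indegree G[A] o u)
  oddᴬ u u∈A u≢s = subst Odd (indegreeᴬ u∈A) (odd u (A⊆V u∈A) u≢s)

  Fᴬ : Flexible G[A]
  Fᴬ = decomposable⇒flexible G[A] (decompose G[A] o s (rs (x∈p⇒p-x⊂p v∈V)) acᴬ oddᴬ)

  Fᴮ : Flexible G[B]
  Fᴮ = trivial-flexible G[B] (∣⁅x⁆∣≡1 v , Empty⇒∣p∣≡0 no-edge)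
    where
    no-edge : Empty (Graph.E G[B])
    no-edge (e , e∈) with e∈E , e⊆B ← ∈∩⟦⟧⁻ (bothEndsIn? G ⁅ v ⁆) e∈ =
      sink-v (e , e∈E , x∈⁅y⁆⇒x≡y v (proj₁ (BothEndsIn⇒arcEnds G o e e⊆B)))

  v≢s : v ≢ s
  v≢s refl = p≢1+p (begin
    parity ∣ V - v ∣                          ≡⟨ sym (∑-1 (V - v)) ⟩
    ∑ (V - v) (const 1ℙ)                      ≡⟨ sym (∑-cong (V - v) λ {u} u∈A →
                                                   oddᴬ u u∈A λ { refl → x∉p-x V v u∈A }) ⟩
    ∑ (V - v) (parity ∘ indegree G[A] o)      ≡⟨ ∑-indegree G[A] o ⟩
    parity ∣ Graph.E G[A] ∣                   ≡⟨ proj₁ Fᴬ ⟩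
    1ℙ + parity ∣ V - v ∣                     ∎)
    where open ≡-Reasoning

  -- As `v` is never a tail, the cut edges are exactly the arcs into `v`, and its indegree is odd
  -- because `v` is not `s`.
  odd-d : Odd (d G (V - v) ⁅ v ⁆)
  odd-d = subst Odd (cong ∣_∣ (⊆-antisym to from)) (odd v v∈V v≢s)
    where
    to : fibre E (head G o) v ⊆ X p
    to {e} e∈ with e∈E , refl ← ∈-fibre⁻ (head G o) e∈ =
      ∈∩⟦⟧⁺ (between? G (V - v) ⁅ v ⁆) e∈E
        (arcEnds⇒Between G o e (tail∈A e∈E) (x∈⁅x⁆ v))
    from : X p ⊆ fibre E (head G o) v
    from {e} e∈ with e∈E , b ← ∈∩⟦⟧⁻ (between? G (V - v) ⁅ v ⁆) e∈
                with Between⇒arcEnds G o e b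
    ... | inj₁ (_ , h∈B) = ∈-fibre⁺ (head G o) e∈E (x∈⁅y⁆⇒x≡y v h∈B)
    ... | inj₂ (t∈B , _) = ⊥-elim (disj p (tail∈A e∈E) t∈B)

-- Equivalence of the four statements

module _ (G : Graph n m) where
  open Graph G

  dualCritical⇒decomposable : DualCritical G → Decomposable G
  dualCritical⇒decomposable (o , ac , s , _ , _ , odd) =
    decompose G o s (⊂-wellFounded V) ac odd

  dualCritical⇒flexible : DualCritical G → Flexible G
  dualCritical⇒flexible = decomposable⇒flexible G ∘ dualCritical⇒decomposable

  T-odd⇒oddExceptAt : ∀ o {v} → v ∈ V → IsOdd G o (V - v) → OddExceptAt G o v
  T-odd⇒oddExceptAt o {v} v∈V odd =
    proj₂ (odd v v∈V) (x∉p-x V v) ,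
    λ u u∈V u≢v → proj₁ (odd u u∈V) (x∈p∧x≢y⇒x∈p-y u∈V u≢v)

  flexible⇒T-odd : Flexible G → ∀ T → T ⊆ V → ∣ T ∣ ≡₂ ∣ E ∣ →
    ∃[ o ] Acyclic G o × IsOdd G o T
  flexible⇒T-odd (_ , realise) T T⊆V T≡E =
    -- The prescription is the indicator function of `T`; its sum over `V` is the parity of
    -- `∣ V ∩ T ∣`, where `V ∩ T` is `T`.
    let o , ac , degrees = realise (ι ∘ lookup T)
          (trans (∑-lookup V T) (trans (cong (parity ∘ ∣_∣) V∩T≡T) T≡E))
    in o , ac , λ v v∈V →
      (λ v∈T → trans (degrees v v∈V) (cong ι ([]=⇒lookup v∈T))) ,
      (λ v∉T → trans (degrees v v∈V) (cong ι (lookup-∉ v∉T)))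
    where
    V∩T≡T : V ∩ T ≡ T
    V∩T≡T = ⊆-antisym (p∩q⊆q V T) (λ x∈T → x∈p∩q⁺ (T⊆V x∈T , x∈T))

  -- Take `T` to be `V - v`: flexibility makes `∣ E ∣` differ in parity from `∣ V ∣`, and so does
  -- removing one vertex.
  flexible⇒oddExceptAt : Flexible G → ∀ v → v ∈ V → ∃[ o ] Acyclic G o × OddExceptAt G o v
  flexible⇒oddExceptAt F v v∈V =
    let o , ac , odd = flexible⇒T-odd F (V - v) (p─q⊆p V ⁅ v ⁆) V-v≡E
    in o , ac , T-odd⇒oddExceptAt o v∈V odd
    where
    V-v≡E : ∣ V - v ∣ ≡₂ ∣ E ∣
    V-v≡E = sym (trans (proj₁ F)
      (trans (cong (1ℙ +_) (parity-remove V v∈V)) (p+[p+q]≡q 1ℙ _)))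

  oddExceptAt⇒dualCritical : ∀ {v} → v ∈ V → ∃[ o ] Acyclic G o × OddExceptAt G o v →
    DualCritical G
  oddExceptAt⇒dualCritical v∈V (o , ac , odd) = o , ac , _ , v∈V , odd

  flexible⇒dualCritical : Flexible G → DualCritical G
  flexible⇒dualCritical F with v , v∈V ← V-nonempty =
    oddExceptAt⇒dualCritical v∈V (flexible⇒oddExceptAt F v v∈V)

  flexible⇒V≢E : Flexible G → ¬ (∣ V ∣ ≡₂ ∣ E ∣)
  flexible⇒V≢E (count , _) V≡E = p≢1+p (trans V≡E count)

  -- For any vertex `v` the set `V - v` is a proper subset, and its size has the parity other than
  -- that of `∣ V ∣`, which is the parity of `∣ E ∣`.
  T-odd⇒dualCritical : ¬ (∣ V ∣ ≡₂ ∣ E ∣) →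
    (∀ T → T ⊂ V → ∣ T ∣ ≡₂ ∣ E ∣ → ∃[ o ] Acyclic G o × IsOdd G o T) →
    DualCritical G
  T-odd⇒dualCritical V≢E T-odd
    with v , v∈V ← V-nonempty
    with o , ac , odd ← T-odd (V - v) (x∈p⇒p-x⊂p v∈V)
                          (p≢q∧p≡1+r⇒r≡q V≢E (parity-remove V v∈V)) =
    oddExceptAt⇒dualCritical v∈V (o , ac , T-odd⇒oddExceptAt o v∈V odd)

theorem3 : ∀ {n m : ℕ} (G : Graph n m) →
    let open Graph G
        S₁ = DualCritical G
        S₂ = ∀ v → v ∈ V → ∃[ o ] Acyclic G o × OddExceptAt G o v
        S₃ = ¬ (∣ V ∣ ≡₂ ∣ E ∣) ×
             (∀ T → T ⊂ V → ∣ T ∣ ≡₂ ∣ E ∣ → ∃[ o ] Acyclic G o × IsOdd G o T)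
        S₄ = (∣ V ∣ ≡ 1 × ∣ E ∣ ≡ 0) ⊎
             (∃[ A ] ∃[ B ] Σ[ p ∈ IsPartition G A B ]
                DualCritical (IsPartition.G[A] p) ×
                DualCritical (IsPartition.G[B] p) ×
                Odd (d G A B))
    in (S₁ ⇔ S₂) × (S₁ ⇔ S₃) × (S₁ ⇔ S₄)
theorem3 G =
  mk⇔ (flexible⇒oddExceptAt G ∘ dualCritical⇒flexible G)
      (λ S₂ → oddExceptAt⇒dualCritical G (proj₂ V-nonempty) (S₂ _ (proj₂ V-nonempty))) ,
  mk⇔ (λ S₁ → let F = dualCritical⇒flexible G S₁
               in flexible⇒V≢E G F , λ T T⊂V → flexible⇒T-odd G F T (p⊂q⇒p⊆q T⊂V))
      (λ S₃ → T-odd⇒dualCritical G (proj₁ S₃) (proj₂ S₃)) ,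
  -- `Decomposable` becomes (4) by exchanging flexible and dual-critical on both classes, two
  -- properties now known to be equivalent for every graph.
  mk⇔ (Sum.map₂ (λ (A , B , p , Fᴬ , Fᴮ , odd) →
          A , B , p , flexible⇒dualCritical _ Fᴬ , flexible⇒dualCritical _ Fᴮ , odd)
        ∘ dualCritical⇒decomposable G)
      (flexible⇒dualCritical G ∘ decomposable⇒flexible G ∘
        Sum.map₂ (λ (A , B , p , Dᴬ , Dᴮ , odd) →
          A , B , p , dualCritical⇒flexible _ Dᴬ , dualCritical⇒flexible _ Dᴮ , odd))
  where open Graph G
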